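{- There is a function $f$ such that, for every graph $H$ and every positive integer $t$, one of the following holds: (i) $K_t$ is a projection of $H$; (ii) $K_{t,t,t}$ is a projection of $H$; (iii) an extended biclique can be obtained from $H$ by deleting at most $f(t)$ vertices.
   Context: A graph $H'$ is a projection of $H$ if $H'$ can be obtained from $H$ by a sequence of vertex deletions and identifications of two nonadjacent vertices. $K_{t,t,t}$ is the complete tripartite graph with three parts of size $t$. An extended biclique is a complete bipartite graph together with a set of isolated vertices. -}

module Defs where

open import Data.Nat using (ℕ; zero; suc; _*_)
open import Data.Fin using (Fin; punchIn; punchOut; quotient; _≟_)
open import Data.Fin.Properties using (punchOut-injective; any?)
open import Data.Product using (Σ; ∃₂; _×_; _,_)
open import Function using (_∘_; _⇔_; _↔_; Inverse)
open import Level using (0ℓ)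
open import Relation.Binary using (Rel; Symmetric; Irreflexive; Decidable)
open import Relation.Binary.PropositionalEquality using (_≡_; _≢_; refl; sym; trans; ≢-sym)
open import Relation.Nullary using (¬_; yes; no)
open import Relation.Nullary.Decidable using (_×-dec_; ¬?)

-- Finite simple graphs with vertex set Fin n.
record Graph (n : ℕ) : Set₁ where
  field
    Adj        : Rel (Fin n) 0ℓ
    adj-sym    : Symmetric Adj
    adj-irrefl : Irreflexive _≡_ Adj
    adj?       : Decidable Adj

open Graph public

record _≅_ {m n : ℕ} (G : Graph m) (H : Graph n) : Set where
  field
    bijection : Fin m ↔ Fin n
    adj-iff   : ∀ x y → Adj G x y ⇔ Adj H (Inverse.to bijection x) (Inverse.to bijection y)

deleteVertex : ∀ {n} → Graph (suc n) → Fin (suc n) → Graph n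
deleteVertex G v = record
  { Adj        = λ x y → Adj G (punchIn v x) (punchIn v y)
  ; adj-sym    = adj-sym G
  ; adj-irrefl = λ { refl → adj-irrefl G refl }
  ; adj?       = λ x y → adj? G (punchIn v x) (punchIn v y)
  }

-- The quotient map Fin (suc n) → Fin n whose only nontrivial fibre is {u , v}:
-- u is sent to the image of v, and the vertices other than u are renumbered.
merge : ∀ {n} {u v : Fin (suc n)} → u ≢ v → Fin (suc n) → Fin n
merge {u = u} u≢v x with u ≟ x
... | yes _   = punchOut u≢v
... | no  u≢x = punchOut u≢x

merge-fibre : ∀ {n} (G : Graph (suc n)) {u v : Fin (suc n)} (u≢v : u ≢ v) →
              ¬ Adj G u v → ∀ a b → merge u≢v a ≡ merge u≢v b → ¬ Adj G a b
merge-fibre G {u} u≢v u≁v a b eq with u ≟ a | u ≟ b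
... | yes refl | yes refl = adj-irrefl G refl
... | yes refl | no  u≢b  with refl ← punchOut-injective u≢v u≢b eq = u≁v
... | no  u≢a  | yes refl with refl ← punchOut-injective u≢a u≢v eq = u≁v ∘ adj-sym G
... | no  u≢a  | no  u≢b  = adj-irrefl G (punchOut-injective u≢a u≢b eq)

-- Parallel edges created by the identification are merged, as Adj is a relation.
identifyVertices : ∀ {n} (G : Graph (suc n)) {u v : Fin (suc n)} → u ≢ v → ¬ Adj G u v → Graph n
identifyVertices G u≢v u≁v = record
  { Adj        = λ x y → ∃₂ λ a b → π a ≡ x × π b ≡ y × Adj G a b
  ; adj-sym    = λ { (a , b , p , q , ab) → b , a , q , p , adj-sym G ab }
  ; adj-irrefl = λ { refl (a , b , p , q , ab) → merge-fibre G u≢v u≁v a b (trans p (sym q)) ab }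
  ; adj?       = λ x y → any? λ a → any? λ b → (π a ≟ x) ×-dec (π b ≟ y) ×-dec adj? G a b
  }
  where π = merge u≢v

infix 4 _≅_ _IsProjectionOf_

data _IsProjectionOf_ {k : ℕ} (H′ : Graph k) : ∀ {n} → Graph n → Set₁ where
  iso      : ∀ {n} {H : Graph n} → H ≅ H′ → H′ IsProjectionOf H
  delete   : ∀ {n} {H : Graph (suc n)} (v : Fin (suc n)) →
             H′ IsProjectionOf deleteVertex H v → H′ IsProjectionOf H
  identify : ∀ {n} {H : Graph (suc n)} {u v : Fin (suc n)} (u≢v : u ≢ v) (u≁v : ¬ Adj H u v) →
             H′ IsProjectionOf identifyVertices H u≢v u≁v → H′ IsProjectionOf H

complete : ∀ t → Graph t
complete t = record
  { Adj        = _≢_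
  ; adj-sym    = ≢-sym
  ; adj-irrefl = λ x≡y x≢y → x≢y x≡y
  ; adj?       = λ x y → ¬? (x ≟ y)
  }

-- K_{t,t,t}: the part of a vertex is its quotient by t, so the parts are three
-- consecutive blocks of t vertices.
completeTripartite : ∀ t → Graph (3 * t)
completeTripartite t = record
  { Adj        = λ x y → part x ≢ part y
  ; adj-sym    = ≢-sym
  ; adj-irrefl = λ { refl x≢x → x≢x refl }
  ; adj?       = λ x y → ¬? (part x ≟ part y)
  }
  where
  part : Fin (3 * t) → Fin 3
  part = quotient t

data Role : Set where
  left right isolated : Role

data Joined : Role → Role → Set where
  left-right : Joined left right
  right-left : Joined right left

-- Any of the three classes may be empty; in particular edgeless graphs, including
-- the graph without vertices, are extended bicliques.
IsExtendedBiclique : ∀ {n} → Graph n → Set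
IsExtendedBiclique {n} G =
  Σ (Fin n → Role) λ role → ∀ x y → Adj G x y ⇔ Joined (role x) (role y)

-- DeletesTo k G G′: deleting k vertices from G, one after another, gives G′.
data DeletesTo : ∀ {m n} → ℕ → Graph m → Graph n → Set₁ where
  done   : ∀ {n} {G : Graph n} → DeletesTo zero G G
  delete : ∀ {m n k} {G : Graph (suc m)} {G′ : Graph n} (v : Fin (suc m)) →
           DeletesTo k (deleteVertex G v) G′ → DeletesTo (suc k) G G′

{-# OPTIONS --safe #-}
module Submission where

-- A projection is given by disjoint independent bags of vertices. Call two vertices
-- twins if no vertex is adjacent to exactly one of them. Among many pairwise
-- separated vertices, repeated halving extracts a long sequence (xᵢ , yᵢ) in which yᵢ
-- separates xᵢ from all later xⱼ; by Ramsey's theorem it contains a clique, a half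
-- graph, an induced matching or a similar pattern, and each of them has bags
-- realising K_t. Otherwise there are few twin classes, and deleting 6t vertices from
-- each (all of them, if there are fewer) leaves only vertices with 6t twins in H. If
-- what is left is not an extended biclique, it contains three nonadjacent pairs of
-- vertices, possibly overlapping, any two of which are joined by an edge (coming from
-- a triangle, a P₄ or a 2K₂). Replacing the pairs by t disjoint copies each,
-- made of distinct twins, gives K_{t,t,t}.

open import Data.Nat using (ℕ; _≤_)
open import Data.Product using (Σ; ∃; _×_)
open import Data.Sum using (_⊎_)
open import Defs
open import Data.Bool using (true; false)
open import Data.Fin as Fin
  using (Fin; zero; suc; punchIn; punchOut; inject₁; fromℕ; combine; quotient; _≟_)
open import Data.Fin.Properties
  using (any?; punchIn-punchOut; punchInᵢ≢i; punchIn-injective; pigeonhole; <-cmp;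
         toℕ-inject₁; toℕ-fromℕ; toℕ<n; toℕ-injective; combine-injective)
open import Data.List
  using (List; []; _∷_; _++_; length; filter; take; concatMap; tabulate; allFin; lookup)
open import Data.List.Membership.Propositional using (_∈_; _∉_; find; lose)
open import Data.List.Membership.Propositional.Properties
  using (∈-filter⁺; ∈-filter⁻; ∈-concatMap⁺; ∈-tabulate⁺; ∈-allFin)
open import Data.List.Properties using (length-++; length-take; length-tabulate; take-all)
open import Data.List.Relation.Unary.All as All using (All; []; _∷_)
import Data.List.Relation.Unary.All.Properties as All
open import Data.List.Relation.Unary.AllPairs using (AllPairs; []; _∷_)
import Data.List.Relation.Unary.AllPairs.Properties as AllPairs
open import Data.List.Relation.Unary.Any as Any using (Any; here; there)
import Data.List.Relation.Unary.Any.Properties as Any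
import Data.List.Relation.Unary.Unique.Propositional.Properties as Unique
open import Data.Nat using (zero; suc; _+_; _*_; _^_; _⊓_; _<_; z≤n; s≤s; z<s; s<s)
open import Data.Nat.Properties hiding (_≟_; <-cmp)
open import Data.Product using (∃₂; _,_; proj₁; proj₂)
open import Data.Sum using (inj₁; inj₂; [_,_]′)
open import Data.Unit using (⊤; tt)
open import Function using (_∘_; case_of_; _⇔_; mk⇔; mk↔ₛ′; Equivalence; id; const; flip)
open import Level using (0ℓ)
open import Relation.Binary using (Rel; Decidable; tri<; tri≈; tri>)
open import Relation.Binary.PropositionalEquality
  using (_≡_; _≢_; refl; sym; trans; cong; subst; subst₂)
open import Relation.Nullary using (¬_; Dec; yes; no; does; contradiction)
open import Relation.Nullary.Decidable using (_×-dec_; _⊎-dec_; ¬?; decidable-stable)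
import Relation.Unary as U

open Equivalence using (to; from)

private variable
  k m n t : ℕ
  A : Set
  R S : Rel A 0ℓ

-- Bags realising T inside H

-- Each bag is to be identified to a single vertex, and vertices outside all bags are to be deleted.
-- Bags are independent because `sound` with equal indices would give a loop in `T`.
record Model {k n} (T : Graph k) (H : Graph n) : Set₁ where
  field
    Bag       : Fin k → Fin n → Set
    bag?      : ∀ i x → Dec (Bag i x)
    disjoint  : ∀ {i j x} → Bag i x → Bag j x → i ≡ j
    inhabited : ∀ i → ∃ (Bag i)
    sound     : ∀ {i j x y} → Bag i x → Bag j y → Adj H x y → Adj T i j
    realised  : ∀ {i j} → Adj T i j → ∃₂ λ x y → Bag i x × Bag j y × Adj H x y

deleteUnbagged : {T : Graph k} {H : Graph (suc n)} (M : Model T H) (v : Fin (suc n)) →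
                 (∀ i → ¬ Model.Bag M i v) → Model T (deleteVertex H v)
deleteUnbagged {k} {n} {T} {H} M v unbagged = record
  { Bag       = Bag′
  ; bag?      = λ i x → bag? i (punchIn v x)
  ; disjoint  = disjoint
  ; inhabited = λ i → let x , b = inhabited i in _ , restrict b
  ; sound     = sound
  ; realised  = λ ij → let x , y , bx , by , xy = realised ij in
      _ , _ , restrict bx , restrict by ,
      subst₂ (Adj H) (sym (punchIn-punchOut (v≢ bx))) (sym (punchIn-punchOut (v≢ by))) xy
  }
  where
  open Model M
  Bag′ : Fin k → Fin n → Set
  Bag′ i x = Bag i (punchIn v x)
  v≢ : ∀ {i x} → Bag i x → v ≢ x
  v≢ b refl = unbagged _ b
  restrict : ∀ {i x} (b : Bag i x) → Bag′ i (punchOut (v≢ b))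
  restrict {i} b = subst (Bag i) (sym (punchIn-punchOut (v≢ b))) b

-- The identified vertex is represented by `v`, so a new bag is tested at `punchIn u x`. As `u` and
-- `v` share a bag, `merge` preserves and reflects membership.
identifyWithinBag : {T : Graph k} {H : Graph (suc n)} (M : Model T H) {u v : Fin (suc n)}
                    (u≢v : u ≢ v) (u≁v : ¬ Adj H u v) {i : Fin k} →
                    Model.Bag M i u → Model.Bag M i v → Model T (identifyVertices H u≢v u≁v)
identifyWithinBag {k} {n} {T} {H} M {u} {v} u≢v u≁v bu bv = record
  { Bag       = Bag′
  ; bag?      = λ i x → bag? i (punchIn u x)
  ; disjoint  = disjoint
  ; inhabited = λ i → let x , b = inhabited i in _ , push x b
  ; sound     = λ { bx by (a , b , refl , refl , ab) → sound (pull a bx) (pull b by) ab }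
  ; realised  = λ ij → let x , y , bx , by , xy = realised ij in
      _ , _ , push x bx , push y by , x , y , refl , refl , xy
  }
  where
  open Model M
  Bag′ : Fin k → Fin n → Set
  Bag′ i x = Bag i (punchIn u x)
  push : ∀ {i} x → Bag i x → Bag′ i (merge u≢v x)
  push {i} x b with u ≟ x
  ... | yes refl = subst (Bag i) (sym (punchIn-punchOut u≢v)) (subst (λ j → Bag j v) (disjoint bu b) bv)
  ... | no  u≢x  = subst (Bag i) (sym (punchIn-punchOut u≢x)) b
  pull : ∀ {i} x → Bag′ i (merge u≢v x) → Bag i x
  pull {i} x b with u ≟ x
  ... | yes refl = let b′ = subst (Bag i) (punchIn-punchOut u≢v) b in
                   subst (λ j → Bag j u) (disjoint bv b′) bu
  ... | no  u≢x  = subst (Bag i) (punchIn-punchOut u≢x) b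

singletonBags : {T : Graph k} {H : Graph n} (M : Model T H) →
                (∀ x → ∃ λ i → Model.Bag M i x) →
                (∀ {i x y} → Model.Bag M i x → Model.Bag M i y → x ≡ y) → H ≅ T
singletonBags {H = H} M bagged single = record
  { bijection = mk↔ₛ′ (proj₁ ∘ bagged) (proj₁ ∘ inhabited)
      (λ i → disjoint (proj₂ (bagged _)) (proj₂ (inhabited i)))
      (λ x → single (proj₂ (inhabited _)) (proj₂ (bagged x)))
  ; adj-iff = λ x y → mk⇔ (sound (proj₂ (bagged x)) (proj₂ (bagged y)))
      (λ ij → let _ , _ , bx , by , xy = realised ij in
              subst₂ (Adj H) (single bx (proj₂ (bagged x))) (single by (proj₂ (bagged y))) xy)
  }
  where open Model M

-- Induction on the number of vertices: delete a vertex in no bag, or else identify two vertices of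
-- one bag. When neither exists, the bags are singletons covering `H`.
model⇒projection : {T : Graph k} {H : Graph n} → Model T H → T IsProjectionOf H
model⇒projection {n = zero} M =
  iso (singletonBags M (λ ()) λ { {x = ()} })
model⇒projection {n = suc n} {T} {H} M
  with any? (λ x → ¬? (any? (λ i → Model.bag? M i x)))
     | any? (λ u → any? (λ v → any? (λ i →
         ¬? (u ≟ v) ×-dec Model.bag? M i u ×-dec Model.bag? M i v)))
... | yes (v , unbagged) | _ =
  delete v (model⇒projection (deleteUnbagged M v (λ i b → unbagged (i , b))))
... | no _ | yes (u , v , i , u≢v , bu , bv) =
  identify u≢v u≁v (model⇒projection (identifyWithinBag M u≢v u≁v bu bv))
  where
  u≁v : ¬ Adj H u v
  u≁v = adj-irrefl T refl ∘ Model.sound M bu bv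
... | no ¬unbagged | no ¬repeated = iso (singletonBags M
  (λ x → decidable-stable (any? λ i → Model.bag? M i x) (λ ¬b → ¬unbagged (x , ¬b)))
  (λ {i} {x} {y} bx by → decidable-stable (x ≟ y) (λ x≢y → ¬repeated (x , y , i , x≢y , bx , by))))

-- Bags of at most two vertices

module _ {n} (G : Graph n) where

  Cell : Set
  Cell = Fin n × Fin n

  Hit : Cell → Fin n → Set
  Hit (p , q) x = x ≡ p ⊎ x ≡ q

  hit? : ∀ c x → Dec (Hit c x)
  hit? (p , q) x = (x ≟ p) ⊎-dec (x ≟ q)

  Disjoint : Cell → Cell → Set
  Disjoint c d = ∀ {x} → Hit c x → ¬ Hit d x

  Linked : Cell → Cell → Set
  Linked c d = ∃₂ λ x y → Hit c x × Hit d y × Adj G x y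

  linked? : ∀ c d → Dec (Linked c d)
  linked? c d = any? λ x → any? λ y → hit? c x ×-dec hit? d y ×-dec adj? G x y

  linked-sym : ∀ {c d} → Linked c d → Linked d c
  linked-sym (x , y , cx , dy , xy) = y , x , dy , cx , adj-sym G xy

  independentCell : ∀ {p q} → ¬ Adj G p q → ¬ Linked (p , q) (p , q)
  independentCell p≁q (_ , _ , inj₁ refl , inj₁ refl , pp) = adj-irrefl G refl pp
  independentCell p≁q (_ , _ , inj₁ refl , inj₂ refl , pq) = p≁q pq
  independentCell p≁q (_ , _ , inj₂ refl , inj₁ refl , qp) = p≁q (adj-sym G qp)
  independentCell p≁q (_ , _ , inj₂ refl , inj₂ refl , qq) = adj-irrefl G refl qq

  cellModel : {T : Graph k} (c : Fin k → Cell) →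
              (∀ {i j} → i ≢ j → Disjoint (c i) (c j)) →
              (∀ {i j} → Adj T i j ⇔ Linked (c i) (c j)) → Model T G
  cellModel c disj link = record
    { Bag       = Hit ∘ c
    ; bag?      = hit? ∘ c
    ; disjoint  = λ {i} {j} ix jx → decidable-stable (i ≟ j) (λ i≢j → disj i≢j ix jx)
    ; inhabited = λ i → _ , inj₁ refl
    ; sound     = λ ix jy xy → from link (_ , _ , ix , jy , xy)
    ; realised  = to link
    }

  completeCellModel : (c : Fin t → Cell) →
                      (∀ i → ¬ Linked (c i) (c i)) →
                      (∀ {i j} → i Fin.< j → Disjoint (c i) (c j)) →
                      (∀ {i j} → i Fin.< j → Linked (c i) (c j)) → Model (complete t) G
  completeCellModel c indep disj link = cellModel c disj′
    (λ {i} {j} → mk⇔ link′ λ { l refl → indep i l })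
    where
    disj′ : ∀ {i j} → i ≢ j → Disjoint (c i) (c j)
    disj′ {i} {j} i≢j with <-cmp i j
    ... | tri< i<j _ _ = disj i<j
    ... | tri≈ _ i≡j _ = contradiction i≡j i≢j
    ... | tri> _ _ j<i = flip (disj j<i)
    link′ : ∀ {i j} → i ≢ j → Linked (c i) (c j)
    link′ {i} {j} i≢j with <-cmp i j
    ... | tri< i<j _ _ = link i<j
    ... | tri≈ _ i≡j _ = contradiction i≡j i≢j
    ... | tri> _ _ j<i = linked-sym (link j<i)

-- Ramsey's theorem for chains

Chain : Rel A 0ℓ → ℕ → Set
Chain R m = ∃ λ xs → m ≤ length xs × AllPairs R xs

Increasing : Rel A 0ℓ → ℕ → Set
Increasing {A} R m = Σ (Fin m → A) λ s → ∀ {i j} → i Fin.< j → R (s i) (s j)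

module _ {A : Set} where

  prefix : ∀ m (xs : List A) → m ≤ length xs → Fin m → A
  prefix (suc m) (x ∷ xs) (s≤s m≤) zero    = x
  prefix (suc m) (x ∷ xs) (s≤s m≤) (suc i) = prefix m xs m≤ i

  prefix∈ : ∀ m (xs : List A) (m≤ : m ≤ length xs) i → prefix m xs m≤ i ∈ xs
  prefix∈ (suc m) (x ∷ xs) (s≤s m≤) zero    = here refl
  prefix∈ (suc m) (x ∷ xs) (s≤s m≤) (suc i) = there (prefix∈ m xs m≤ i)

  prefix-increasing : ∀ {R : Rel A 0ℓ} m (xs : List A) (m≤ : m ≤ length xs) → AllPairs R xs →
                      ∀ {i j} → i Fin.< j → R (prefix m xs m≤ i) (prefix m xs m≤ j)
  prefix-increasing (suc m) (x ∷ xs) (s≤s m≤) (rx ∷ _) {zero} {suc j} _ =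
    All.lookup rx (prefix∈ m xs m≤ j)
  prefix-increasing (suc m) (x ∷ xs) (s≤s m≤) (_ ∷ rxs) {suc i} {suc j} (s<s i<j) =
    prefix-increasing m xs m≤ rxs i<j

  chain⇒increasing : ∀ {R : Rel A 0ℓ} → Chain R m → Increasing R m
  chain⇒increasing (xs , m≤ , rxs) = prefix _ xs m≤ , prefix-increasing _ xs m≤ rxs

module _ {A : Set} {P : U.Pred A 0ℓ} (P? : U.Decidable P) where

  length-filter-split : ∀ xs → length (filter P? xs) + length (filter (¬? ∘ P?) xs) ≡ length xs
  length-filter-split []       = refl
  length-filter-split (x ∷ xs) with does (P? x)
  ... | true  = cong suc (length-filter-split xs)
  ... | false = trans (+-suc _ _) (cong suc (length-filter-split xs))

  -- The slack of one pays for a head set aside before its tail is split: `2 * c` elements without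
  -- one still leave `c` on one side.
  larger-half : ∀ c xs → 2 * c ≤ suc (length xs) →
                c ≤ length (filter P? xs) ⊎ c ≤ length (filter (¬? ∘ P?) xs)
  larger-half c xs 2c≤ with ≤-<-connex c (length (filter P? xs)) | ≤-<-connex c (length (filter (¬? ∘ P?) xs))
  ... | inj₁ c≤ | _       = inj₁ c≤
  ... | _       | inj₁ c≤ = inj₂ c≤
  ... | inj₂ a< | inj₂ b< = contradiction 2c≤ (<⇒≱ (begin-strict
    suc (length xs)                                              ≡⟨ cong suc (length-filter-split xs) ⟨
    suc (length (filter P? xs) + length (filter (¬? ∘ P?) xs))   <⟨ s≤s (≤-reflexive (sym (+-suc _ _))) ⟩
    suc (length (filter P? xs)) + suc (length (filter (¬? ∘ P?) xs)) ≤⟨ +-mono-≤ a< b< ⟩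
    c + c                                                        ≡⟨ cong (c +_) (+-identityʳ c) ⟨
    2 * c                                                        ∎))
    where open ≤-Reasoning

module _ {A : Set} {S R : Rel A 0ℓ} (R? : Decidable R) where

  -- The head stays with the larger of its two colour classes in the tail, and `a` or `b` drops by
  -- one. `Q` records how the remaining elements relate to the heads set aside, so that these can be
  -- put back in front.
  ramsey-list : {Q : U.Pred A 0ℓ} → ∀ a b xs → 2 ^ (a + b) ≤ length xs → AllPairs S xs → All Q xs →
    (∃ λ ys → a ≤ length ys × AllPairs (λ x y → S x y × R x y) ys × All Q ys) ⊎
    (∃ λ ys → b ≤ length ys × AllPairs (λ x y → S x y × ¬ R x y) ys × All Q ys)
  ramsey-list zero    b       xs       _  _ _ = inj₁ ([] , z≤n , [] , [])
  ramsey-list (suc a) zero    xs       _  _ _ = inj₂ ([] , z≤n , [] , [])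
  ramsey-list (suc a) (suc b) []       le _ _ = contradiction le (<⇒≱ (m^n>0 2 (suc a + suc b)))
  ramsey-list (suc a) (suc b) (x ∷ xs) le (sx ∷ sxs) (qx ∷ qxs)
    with larger-half (R? x) (2 ^ (a + suc b)) xs le
  ... | inj₁ le′
    with ramsey-list a (suc b) (filter (R? x) xs) le′ (AllPairs.filter⁺ (R? x) sxs)
           (All.zip (All.filter⁺ (R? x) qxs , All.zip (All.filter⁺ (R? x) sx , All.all-filter (R? x) xs)))
  ...   | inj₁ (ys , a≤ , rys , qys) = inj₁ (x ∷ ys , s≤s a≤ , All.map proj₂ qys ∷ rys , qx ∷ All.map proj₁ qys)
  ...   | inj₂ (ys , b≤ , rys , qys) = inj₂ (ys , b≤ , rys , All.map proj₁ qys)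
  ramsey-list (suc a) (suc b) (x ∷ xs) le (sx ∷ sxs) (qx ∷ qxs) | inj₂ le′
    with ramsey-list (suc a) b (filter (¬? ∘ R? x) xs)
           (subst (λ e → 2 ^ e ≤ length (filter (¬? ∘ R? x) xs)) (+-suc a b) le′)
           (AllPairs.filter⁺ (¬? ∘ R? x) sxs)
           (All.zip (All.filter⁺ (¬? ∘ R? x) qxs ,
                     All.zip (All.filter⁺ (¬? ∘ R? x) sx , All.all-filter (¬? ∘ R? x) xs)))
  ...   | inj₁ (ys , a≤ , rys , qys) = inj₁ (ys , a≤ , rys , All.map proj₁ qys)
  ...   | inj₂ (ys , b≤ , rys , qys) = inj₂ (x ∷ ys , s≤s b≤ , All.map proj₂ qys ∷ rys , qx ∷ All.map proj₁ qys)

  ramsey : ∀ a b → Chain S (2 ^ (a + b)) →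
           Chain (λ x y → S x y × R x y) a ⊎ Chain (λ x y → S x y × ¬ R x y) b
  ramsey a b (xs , le , sxs) with ramsey-list {Q = λ _ → ⊤} a b xs le sxs (All.universal (λ _ → tt) xs)
  ... | inj₁ (ys , a≤ , rys , _) = inj₁ (ys , a≤ , rys)
  ... | inj₂ (ys , b≤ , rys , _) = inj₂ (ys , b≤ , rys)
-- Separating vertices

module _ {n} (G : Graph n) where

  private V = Fin n

  Separates : V → V → V → Set
  Separates y x x′ = (Adj G y x × ¬ Adj G y x′) ⊎ (¬ Adj G y x × Adj G y x′)

  Separated : Rel V 0ℓ
  Separated x x′ = ∃ λ y → Separates y x x′

  separated? : Decidable Separated
  separated? x x′ = any? λ y →
    (adj? G y x ×-dec ¬? (adj? G y x′)) ⊎-dec (¬? (adj? G y x) ×-dec adj? G y x′)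

  Splits : Rel (V × V) 0ℓ
  Splits (x , y) (x′ , _) = Separates y x x′

  split-pair : ∀ {m} xs → 2 ≤ m → m ≤ length xs → AllPairs Separated xs →
               ∃ λ y → ∃₂ λ x x′ → x ∈ xs × x′ ∈ xs × Adj G y x × ¬ Adj G y x′
  split-pair (x ∷ x′ ∷ xs) _ _ (((y , inj₁ (yx , ¬yx′)) ∷ _) ∷ _) =
    y , x , x′ , here refl , there (here refl) , yx , ¬yx′
  split-pair (x ∷ x′ ∷ xs) _ _ (((y , inj₂ (¬yx , yx′)) ∷ _) ∷ _) =
    y , x′ , x , there (here refl) , here refl , yx′ , ¬yx
  split-pair []       2≤ m≤ _ = contradiction (≤-trans 2≤ m≤) λ ()
  split-pair (_ ∷ []) 2≤ m≤ _ = contradiction (≤-trans 2≤ m≤) λ { (s≤s ()) }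

  -- Some `y` distinguishes two vertices of the list. The larger of its neighbourhood and
  -- non-neighbourhood in the list is kept, and the distinguished vertex on the other side is paired
  -- with `y`, which separates it from everything kept.
  splitting-list : ∀ k xs → 2 ^ k ≤ length xs → AllPairs Separated xs →
    ∃ λ ps → k ≤ length ps × AllPairs Splits ps × All (λ p → proj₁ p ∈ xs) ps
  splitting-list zero    xs le sep = [] , z≤n , [] , []
  splitting-list (suc k) xs le sep
    with y , x , x′ , x∈ , x′∈ , yx , ¬yx′ ← split-pair xs (*-monoʳ-≤ 2 (m^n>0 2 k)) le sep
    with larger-half (adj? G y) (2 ^ k) xs (m≤n⇒m≤1+n le)
  ... | inj₁ le′ =
    let ps , k≤ , ss , ∈f = splitting-list k (filter (adj? G y) xs) le′ (AllPairs.filter⁺ (adj? G y) sep)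
        ∈xs = All.map (∈-filter⁻ (adj? G y)) ∈f
    in (x′ , y) ∷ ps , s≤s k≤ , All.map (λ q → inj₂ (¬yx′ , proj₂ q)) ∈xs ∷ ss , x′∈ ∷ All.map proj₁ ∈xs
  ... | inj₂ le′ =
    let ps , k≤ , ss , ∈f = splitting-list k (filter (¬? ∘ adj? G y) xs) le′ (AllPairs.filter⁺ (¬? ∘ adj? G y) sep)
        ∈xs = All.map (∈-filter⁻ (¬? ∘ adj? G y)) ∈f
    in (x , y) ∷ ps , s≤s k≤ , All.map (λ q → inj₁ (yx , proj₂ q)) ∈xs ∷ ss , x∈ ∷ All.map proj₁ ∈xs

  splitting-chain : ∀ k → Chain Separated (2 ^ k) → Chain Splits k
  splitting-chain k (xs , le , sep) =
    let ps , k≤ , ss , _ = splitting-list k xs le sep in ps , k≤ , ss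

-- Complete models from homogeneous sequences

inject₁-mono-< : {i j : Fin n} → i Fin.< j → inject₁ i Fin.< inject₁ j
inject₁-mono-< {i = i} {j} = subst₂ _<_ (sym (toℕ-inject₁ i)) (sym (toℕ-inject₁ j))

inject₁<fromℕ : (i : Fin n) → inject₁ i Fin.< fromℕ n
inject₁<fromℕ {n} i = subst₂ _<_ (sym (toℕ-inject₁ i)) (sym (toℕ-fromℕ n)) (toℕ<n i)

inject₁<suc : (i : Fin n) → inject₁ i Fin.< suc i
inject₁<suc i = s≤s (≤-reflexive (toℕ-inject₁ i))

module _ {n} (G : Graph n) where

  private V = Fin n

  cliqueModel : (x : Fin t → V) → (∀ {i j} → i Fin.< j → Adj G (x i) (x j)) → Model (complete t) G
  cliqueModel x adj = completeCellModel G (λ i → x i , x i)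
    (λ i → independentCell G (adj-irrefl G refl))
    (λ i<j ix jx → adj-irrefl G (trans (sym (hit ix)) (hit jx)) (adj i<j))
    (λ i<j → _ , _ , inj₁ refl , inj₁ refl , adj i<j)
    where
    hit : ∀ {v z : V} → z ≡ v ⊎ z ≡ v → z ≡ v
    hit = [ id , id ]′

  -- The bags are {xᵢ , yᵢ}; the extra last index shows that no yⱼ lies among the xᵢ.
  upperModel : (x y : Fin (suc t) → V) →
    (∀ {i j} → i Fin.< j → ¬ Adj G (y i) (x i) × Adj G (y i) (x j) × ¬ Adj G (x i) (x j)) →
    Model (complete t) G
  upperModel {t} x y h = completeCellModel G (λ i → x (inject₁ i) , y (inject₁ i))
    (λ i → independentCell G (own i ∘ adj-sym G)) disj
    (λ i<j → _ , _ , inj₂ refl , inj₁ refl , up i<j)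
    where
    own : ∀ i → ¬ Adj G (y (inject₁ i)) (x (inject₁ i))
    own i = proj₁ (h (inject₁<fromℕ i))
    up : ∀ {i j} → i Fin.< j → Adj G (y (inject₁ i)) (x (inject₁ j))
    up i<j = proj₁ (proj₂ (h (inject₁-mono-< i<j)))
    last : ∀ i → Adj G (y (inject₁ i)) (x (fromℕ t)) × ¬ Adj G (x (inject₁ i)) (x (fromℕ t))
    last i = proj₂ (h (inject₁<fromℕ i))
    disj : ∀ {i j} → i Fin.< j →
           Disjoint G (x (inject₁ i) , y (inject₁ i)) (x (inject₁ j) , y (inject₁ j))
    -- Two x-vertices are told apart by the earlier y-vertex, two y-vertices by the later x-vertex.
    disj {i} {j} i<j (inj₁ refl) (inj₁ xx) = own i (subst (Adj G _) (sym xx) (up i<j))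
    disj {i} {j} i<j (inj₁ refl) (inj₂ xy) =
      proj₂ (last i) (subst (λ v → Adj G v _) (sym xy) (proj₁ (last j)))
    disj {i} {j} i<j (inj₂ refl) (inj₁ yx) = adj-irrefl G yx (up i<j)
    disj {i} {j} i<j (inj₂ refl) (inj₂ yy) = own j (subst (λ v → Adj G v _) yy (up i<j))

  -- The bags are {xᵢ₊₁ , yᵢ}; the index 0 shows that no yᵢ lies among the other xⱼ.
  halfGraphModel : (x y : Fin (suc t) → V) →
    (∀ {i j} → i Fin.< j →
      Adj G (y i) (x i) × ¬ Adj G (y i) (x j) × Adj G (y j) (x i) × ¬ Adj G (x i) (x j)) →
    Model (complete t) G
  halfGraphModel {t} x y h = completeCellModel G (λ i → x (suc i) , y (inject₁ i))
    (λ i → independentCell G (above i ∘ adj-sym G)) disj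
    (λ i<j → _ , _ , inj₁ refl , inj₂ refl , adj-sym G (below-suc i<j))
    where
    above : ∀ i → ¬ Adj G (y (inject₁ i)) (x (suc i))
    above i = proj₁ (proj₂ (h (inject₁<suc i)))
    below : ∀ i (j : Fin t) → i Fin.≤ inject₁ j → Adj G (y (inject₁ j)) (x i)
    below i j i≤j with m≤n⇒m<n∨m≡n i≤j
    ... | inj₁ i<j = proj₁ (proj₂ (proj₂ (h i<j)))
    -- The diagonal edge is known only for an index with a later one; the last index serves.
    ... | inj₂ i≡j with refl ← toℕ-injective i≡j = proj₁ (h (inject₁<fromℕ j))
    below-suc : ∀ {i j} → i Fin.< j → Adj G (y (inject₁ j)) (x (suc i))
    below-suc {i} {j} i<j = below (suc i) j (subst (suc (Fin.toℕ i) ≤_) (sym (toℕ-inject₁ j)) i<j)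
    disj : ∀ {i j} → i Fin.< j → Disjoint G (x (suc i) , y (inject₁ i)) (x (suc j) , y (inject₁ j))
    disj {i} {j} i<j (inj₁ refl) (inj₁ xx) = above j (subst (Adj G _) xx (below-suc i<j))
    disj {i} {j} i<j (inj₁ refl) (inj₂ xy) = adj-irrefl G (sym xy) (below-suc i<j)
    disj {i} {j} i<j (inj₂ refl) (inj₁ yx) =
      proj₂ (proj₂ (proj₂ (h {zero} {suc j} z<s)))
        (adj-sym G (subst (λ v → Adj G v _) yx (below zero i z≤n)))
    disj {i} {j} i<j (inj₂ refl) (inj₂ yy) =
      above i (subst (λ v → Adj G v _) (sym yy) (below-suc i<j))

  -- Of the t² matching edges, the edge numbered (i , j) has its x-end in bag i and
  -- its y-end in bag j, except that the y-end is discarded when i ≡ j.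
  matchingModel : (x y : Fin (t * t) → V) →
    (∀ i → Adj G (y i) (x i)) → (∀ {i j} → Adj G (y i) (x j) → i ≡ j) →
    (∀ i j → ¬ Adj G (x i) (x j)) → (∀ i j → ¬ Adj G (y i) (y j)) →
    Model (complete t) G
  matchingModel {t} x y edge only x-indep y-indep = record
    { Bag       = Bag
    ; bag?      = λ i v → any? λ j →
        (v ≟ x (combine i j)) ⊎-dec (¬? (j ≟ i) ×-dec (v ≟ y (combine j i)))
    ; disjoint  = disj
    ; inhabited = λ i → _ , i , inj₁ refl
    ; sound     = λ { bx by xy refl → indep bx by xy }
    ; realised  = λ {i} {j} i≢j →
        _ , _ , (j , inj₁ refl) , (i , inj₂ (i≢j , refl)) , adj-sym G (edge (combine i j))
    }
    where
    Bag : Fin t → V → Set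
    Bag i v = ∃ λ j → v ≡ x (combine i j) ⊎ (j ≢ i × v ≡ y (combine j i))
    disj : ∀ {i j v} → Bag i v → Bag j v → i ≡ j
    disj {i} {j} (i′ , inj₁ refl) (j′ , inj₁ xx) =
      proj₁ (combine-injective i i′ j j′ (only (subst (Adj G _) xx (edge _))))
    -- A y-vertex has a neighbour among the x-vertices, an x-vertex has none.
    disj (i′ , inj₁ refl) (j′ , inj₂ (_ , xy)) =
      contradiction (subst (λ v → Adj G v _) (sym xy) (edge _)) (x-indep _ _)
    disj (i′ , inj₂ (_ , refl)) (j′ , inj₁ yx) =
      contradiction (subst (λ v → Adj G v _) yx (edge _)) (x-indep _ _)
    disj {i} {j} (i′ , inj₂ (_ , refl)) (j′ , inj₂ (_ , yy)) =
      proj₂ (combine-injective i′ i j′ j (sym (only (subst (λ v → Adj G v _) yy (edge _)))))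
    indep : ∀ {i v w} → Bag i v → Bag i w → ¬ Adj G v w
    indep (_ , inj₁ refl) (_ , inj₁ refl) = x-indep _ _
    -- Such an edge would be the matching edge numbered (i , i), whose y-end is discarded.
    indep {i} (i′ , inj₁ refl) (j′ , inj₂ (j′≢i , refl)) xy =
      j′≢i (proj₁ (combine-injective j′ i i i′ (only (adj-sym G xy))))
    indep {i} (i′ , inj₂ (i′≢i , refl)) (j′ , inj₁ refl) yx =
      i′≢i (proj₁ (combine-injective i′ i i j′ (only yx)))
    indep (_ , inj₂ (_ , refl)) (_ , inj₂ (_ , refl)) = y-indep _ _

  sequenceMatchingModel : (x y : Fin (suc (t * t)) → V) →
    (∀ {i j} → i Fin.< j →
      Adj G (y i) (x i) × ¬ Adj G (y i) (x j) × ¬ Adj G (y j) (x i) ×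
      ¬ Adj G (x i) (x j) × ¬ Adj G (y i) (y j)) →
    Model (complete t) G
  sequenceMatchingModel x y h = matchingModel (x ∘ inject₁) (y ∘ inject₁)
    (λ i → proj₁ (h (inject₁<fromℕ i))) only
    (indep x λ i<j → proj₁ (proj₂ (proj₂ (proj₂ (h i<j)))))
    (indep y λ i<j → proj₂ (proj₂ (proj₂ (proj₂ (h i<j)))))
    where
    only : ∀ {i j} → Adj G (y (inject₁ i)) (x (inject₁ j)) → i ≡ j
    only {i} {j} yx with <-cmp i j
    ... | tri< i<j _ _ = contradiction yx (proj₁ (proj₂ (h (inject₁-mono-< i<j))))
    ... | tri≈ _ i≡j _ = i≡j
    ... | tri> _ _ j<i = contradiction yx (proj₁ (proj₂ (proj₂ (h (inject₁-mono-< j<i)))))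
    indep : (z : Fin (suc m) → V) → (∀ {i j} → i Fin.< j → ¬ Adj G (z i) (z j)) →
            ∀ i j → ¬ Adj G (z (inject₁ i)) (z (inject₁ j))
    indep z ¬adj i j with <-cmp i j
    ... | tri< i<j _ _ = ¬adj (inject₁-mono-< i<j)
    ... | tri≈ _ refl _ = adj-irrefl G refl
    ... | tri> _ _ j<i = ¬adj (inject₁-mono-< j<i) ∘ adj-sym G

-- Listed from the last use of `ramsey` to the first: each is the exponent `a + b` of one use, one
-- summand being the length that the next use demands. The outer power in `separatedBound` pays for
-- the halving in `splitting-chain`.
halfBound yBound ownBound xBound separatedBound : ℕ → ℕ
halfBound t = suc t + suc (t * t)
yBound t    = t + 2 ^ halfBound t
ownBound t  = 2 ^ yBound t + suc t
xBound t    = t + 2 ^ ownBound t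
separatedBound t = 2 ^ (2 ^ xBound t)

-- Four colourings are made homogeneous in turn: edges among the xᵢ, the edges yᵢxᵢ, edges among the
-- yᵢ, and edges from yⱼ to an earlier xᵢ. Since yᵢ separates xᵢ from later xⱼ, the second colour
-- also determines the edges from yᵢ to later xⱼ.
manySeparated⇒complete : (G : Graph n) (t : ℕ) → Chain (Separated G) (separatedBound t) →
                         Model (complete t) G
manySeparated⇒complete G t sep
  with ramsey {R = λ p q → Adj G (proj₁ p) (proj₁ q)} (λ p q → adj? G (proj₁ p) (proj₁ q))
         t (2 ^ ownBound t) (splitting-chain G (2 ^ xBound t) sep)
... | inj₁ c = let s , h = chain⇒increasing c in cliqueModel G (proj₁ ∘ s) (proj₂ ∘ h)
... | inj₂ c
  -- This colour depends on the earlier pair alone, so nothing is learnt about the last pair of the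
  -- chain.
  with ramsey {R = λ p q → Adj G (proj₂ p) (proj₁ p)} (λ p q → adj? G (proj₂ p) (proj₁ p))
         (2 ^ yBound t) (suc t) c
... | inj₂ c₁ = let s , h = chain⇒increasing c₁ in
  upperModel G (proj₁ ∘ s) (proj₂ ∘ s) λ i<j → case h i<j of λ where
    ((inj₁ (yx , _) , _) , ¬yx)   → contradiction yx ¬yx
    ((inj₂ (_ , yx′) , ¬xx) , ¬yx) → ¬yx , yx′ , ¬xx
... | inj₁ c₁
  with ramsey {R = λ p q → Adj G (proj₂ p) (proj₂ q)} (λ p q → adj? G (proj₂ p) (proj₂ q))
         t (2 ^ halfBound t) c₁
... | inj₁ c₂ = let s , h = chain⇒increasing c₂ in cliqueModel G (proj₂ ∘ s) (proj₂ ∘ h)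
... | inj₂ c₂
  with ramsey {R = λ p q → Adj G (proj₂ q) (proj₁ p)} (λ p q → adj? G (proj₂ q) (proj₁ p))
         (suc t) (suc (t * t)) c₂
... | inj₁ c₃ = let s , h = chain⇒increasing c₃ in
  halfGraphModel G (proj₁ ∘ s) (proj₂ ∘ s) λ i<j → case h i<j of λ where
    ((((inj₁ (_ , ¬yx′) , ¬xx) , yx) , _) , y′x) → yx , ¬yx′ , y′x , ¬xx
    ((((inj₂ (¬yx , _) , _) , yx) , _) , _)      → contradiction yx ¬yx
... | inj₂ c₃ = let s , h = chain⇒increasing c₃ in
  sequenceMatchingModel G (proj₁ ∘ s) (proj₂ ∘ s) λ i<j → case h i<j of λ where
    ((((inj₁ (_ , ¬yx′) , ¬xx) , yx) , ¬yy) , ¬y′x) → yx , ¬yx′ , ¬y′x , ¬xx , ¬yy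
    ((((inj₂ (¬yx , _) , _) , yx) , _) , _)         → contradiction yx ¬yx

-- Twins

module _ {n} (G : Graph n) where

  private V = Fin n

  Twin : Rel V 0ℓ
  Twin x z = ∀ y → Adj G y x ⇔ Adj G y z

  twin-sym : ∀ {x z} → Twin x z → Twin z x
  twin-sym xz y = mk⇔ (from (xz y)) (to (xz y))

  twin-trans : ∀ {x y z} → Twin x y → Twin y z → Twin x z
  twin-trans xy yz w = mk⇔ (to (yz w) ∘ to (xy w)) (from (xy w) ∘ from (yz w))

  unseparated⇒twin : ∀ {x z} → ¬ Separated G x z → Twin x z
  unseparated⇒twin {x} {z} unsep y = mk⇔
    (λ yx → decidable-stable (adj? G y z) λ ¬yz → unsep (y , inj₁ (yx , ¬yz)))
    (λ yz → decidable-stable (adj? G y x) λ ¬yx → unsep (y , inj₂ (¬yx , yz)))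

  separated-irrefl : ∀ {x} → ¬ Separated G x x
  separated-irrefl (y , inj₁ (yx , ¬yx)) = ¬yx yx
  separated-irrefl (y , inj₂ (¬yx , yx)) = ¬yx yx

  separated-sym : ∀ {x z} → Separated G x z → Separated G z x
  separated-sym (y , inj₁ (yx , ¬yz)) = y , inj₂ (¬yz , yx)
  separated-sym (y , inj₂ (¬yx , yz)) = y , inj₁ (yz , ¬yx)

  -- Greedy choice: a vertex joins the list only if it is separated from all representatives so far.
  -- The length of the list decides which half of the proof applies.
  representatives : ∀ xs → ∃ λ rs → AllPairs (Separated G) rs ×
                    All (λ x → Any (λ r → ¬ Separated G r x) rs) xs
  representatives [] = [] , [] , []
  representatives (x ∷ xs) with rs , sep , cover ← representatives xs
    with Any.any? (λ r → ¬? (separated? G r x)) rs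
  ... | yes covered = rs , sep , covered ∷ cover
  ... | no  ¬covered = x ∷ rs
    , All.map (λ {r} ¬¬s → separated-sym (decidable-stable (separated? G r x) ¬¬s))
              (All.¬Any⇒All¬ rs ¬covered) ∷ sep
    , here separated-irrefl ∷ All.map there cover

  TwinFamily : ℕ → V → Set
  TwinFamily s x = Σ (Increasing _≢_ s) λ f → ∀ a → Twin x (proj₁ f a)

  twinsOf : V → List V
  twinsOf r = filter (λ z → ¬? (separated? G r z)) (allFin n)

  truncatedClasses : ℕ → List V → List V
  truncatedClasses s = concatMap (take s ∘ twinsOf)

  length-truncatedClasses : ∀ s rs → length (truncatedClasses s rs) ≤ length rs * s
  length-truncatedClasses s []       = z≤n
  length-truncatedClasses s (r ∷ rs) = begin
    length (take s (twinsOf r) ++ truncatedClasses s rs)         ≡⟨ length-++ (take s (twinsOf r)) ⟩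
    length (take s (twinsOf r)) + length (truncatedClasses s rs) ≡⟨ cong (_+ _) (length-take s (twinsOf r)) ⟩
    s ⊓ length (twinsOf r) + length (truncatedClasses s rs)      ≤⟨ +-mono-≤ (m⊓n≤m s _) (length-truncatedClasses s rs) ⟩
    s + length rs * s                                            ∎
    where open ≤-Reasoning

  -- A class of at most `s` vertices lies wholly in the truncation, so a vertex outside has a class
  -- of at least `s`. The family is taken in the whole graph and may contain vertices of the
  -- truncation.
  twinFamily : ∀ s rs {x} → Any (λ r → ¬ Separated G r x) rs →
               x ∉ truncatedClasses s rs → TwinFamily s x
  twinFamily s rs {x} covered x∉ with r , r∈ , unsep ← find covered
    with ≤-total s (length (twinsOf r))
  ... | inj₁ s≤ = chain⇒increasing (twinsOf r , s≤ , Unique.filter⁺ _ (Unique.allFin⁺ n)) , λ a →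
    twin-trans (twin-sym (unseparated⇒twin unsep))
      (unseparated⇒twin (proj₂ (∈-filter⁻ (λ z → ¬? (separated? G r z)) {xs = allFin n}
        (prefix∈ s (twinsOf r) s≤ a))))
  ... | inj₂ ≤s = contradiction (∈-concatMap⁺ (take s ∘ twinsOf) (lose r∈ x∈)) x∉
    where
    x∈ : x ∈ take s (twinsOf r)
    x∈ = subst (x ∈_) (sym (take-all s (twinsOf r) ≤s))
           (∈-filter⁺ (λ z → ¬? (separated? G r z)) (∈-allFin x) unsep)

  TwinCell : Cell G → Cell G → Set
  TwinCell (p , q) (p′ , q′) = Twin p p′ × Twin q q′

  hit-twin : ∀ {c d x} → TwinCell c d → Hit G c x → ∃ λ x′ → Hit G d x′ × Twin x x′
  hit-twin (pp′ , _) (inj₁ refl) = _ , inj₁ refl , pp′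
  hit-twin (_ , qq′) (inj₂ refl) = _ , inj₂ refl , qq′

  linked-twin : ∀ {c c′ d d′} → TwinCell c c′ → TwinCell d d′ → Linked G c d → Linked G c′ d′
  linked-twin cc′ dd′ (x , y , cx , dy , xy) =
    let x′ , cx′ , xx′ = hit-twin cc′ cx
        y′ , dy′ , yy′ = hit-twin dd′ dy
    in x′ , y′ , cx′ , dy′ , adj-sym G (to (xx′ y′) (adj-sym G (to (yy′ x) xy)))

-- Deleting a list of vertices

-- `DeletesTo` grows at its first deletion, whereas `deleteAll` treats the head of its list last.
deletesTo-snoc : ∀ {G : Graph m} {G′ : Graph (suc n)} → DeletesTo k G G′ → ∀ i →
                 DeletesTo (suc k) G (deleteVertex G′ i)
deletesTo-snoc done         i = delete i done
deletesTo-snoc (delete v d) i = delete v (deletesTo-snoc d i)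

-- Deletions renumber the vertices, so `embed` keeps their original names. Entries of `L` may
-- repeat, hence `count` is only bounded by the length.
record Deletion {n} (G : Graph n) (L : List (Fin n)) : Set₁ where
  constructor deletion
  field
    {count size}    : ℕ
    rest            : Graph size
    count≤          : count ≤ length L
    deletes         : DeletesTo count G rest
    embed           : Fin size → Fin n
    embed-injective : ∀ {x y} → embed x ≡ embed y → x ≡ y
    embed-adj       : ∀ {x y} → Adj rest x y ⇔ Adj G (embed x) (embed y)
    avoids          : ∀ x → embed x ∉ L

deleteMore : {G : Graph n} {L : List (Fin n)} (D : Deletion G L) (i : Fin (Deletion.size D)) →
             Deletion G (Deletion.embed D i ∷ L)
deleteMore (deletion {size = suc _} rest c≤ d e e-inj e-adj av) i = deletion
  (deleteVertex rest i) (s≤s c≤) (deletesTo-snoc d i) (e ∘ punchIn i)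
  (punchIn-injective i _ _ ∘ e-inj) e-adj
  λ { x (here eq) → punchInᵢ≢i i x (e-inj eq) ; x (there x∈) → av _ x∈ }

deleteAll : (G : Graph n) (L : List (Fin n)) → Deletion G L
deleteAll G []      = deletion G z≤n done id id (mk⇔ id id) λ _ ()
deleteAll G (v ∷ L) with D@(deletion r c≤ d e e-inj e-adj av) ← deleteAll G L
  with any? (λ i → e i ≟ v)
... | yes (i , refl) = deleteMore D i
... | no  v∉e        = deletion r (m≤n⇒m≤1+n c≤) d e e-inj e-adj
  λ { x (here eq) → v∉e (x , eq) ; x (there x∈) → av x x∈ }

-- Choosing distinct twins

-- If all `s` values lay in `L`, two would share a position by the pigeonhole principle and be
-- equal.
escape : ∀ {s} (f : Fin s → Fin n) → (∀ {a b} → a Fin.< b → f a ≢ f b) →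
         ∀ L → length L < s → ∃ λ a → f a ∉ L
escape f f≢ L L<s with any? (λ a → ¬? (Any.any? (f a ≟_) L))
... | yes found = found
... | no  ¬found = contradiction collision (f≢ a<b)
  where
  hit : ∀ a → f a ∈ L
  hit a = decidable-stable (Any.any? (f a ≟_) L) λ fa∉ → ¬found (a , fa∉)
  repeat = pigeonhole L<s (Any.index ∘ hit)
  a = proj₁ repeat
  b = proj₁ (proj₂ repeat)
  a<b = proj₁ (proj₂ (proj₂ repeat))
  collision : f a ≡ f b
  collision = trans (Any.lookup-index (hit a))
    (trans (cong (lookup L) (proj₂ (proj₂ (proj₂ repeat)))) (sym (Any.lookup-index (hit b))))

-- Greedy choice: each chosen vertex joins the forbidden list `L`, and the bound leaves a free
-- candidate at every step.
distinctChoice : ∀ m {s} (c : Fin m → Increasing {A = Fin n} _≢_ s) L → length L + m ≤ s →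
  ∃ λ (σ : Fin m → Fin n) →
    (∀ i → ∃ λ a → proj₁ (c i) a ≡ σ i) × (∀ {i j} → σ i ≡ σ j → i ≡ j) × (∀ i → σ i ∉ L)
distinctChoice zero    c L le = (λ ()) , (λ ()) , (λ { {()} }) , λ ()
distinctChoice {n} (suc m) c L le
  with a , x∉ ← escape (proj₁ (c zero)) (proj₂ (c zero)) L
                 (≤-trans (s≤s (m≤m+n _ m)) (≤-trans (≤-reflexive (sym (+-suc _ m))) le))
  with τ , chosen , inj , avoid ← distinctChoice m (c ∘ suc) (proj₁ (c zero) a ∷ L)
                                      (≤-trans (≤-reflexive (sym (+-suc _ m))) le)
  = σ , chosen′ , inj′ , avoid′
  where
  σ : Fin (suc m) → Fin n
  σ zero    = proj₁ (c zero) a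
  σ (suc i) = τ i
  chosen′ : ∀ i → ∃ λ a → proj₁ (c i) a ≡ σ i
  chosen′ zero    = a , refl
  chosen′ (suc i) = chosen i
  inj′ : ∀ {i j} → σ i ≡ σ j → i ≡ j
  inj′ {zero}  {zero}  _  = refl
  inj′ {zero}  {suc j} eq = contradiction (here (sym eq)) (avoid j)
  inj′ {suc i} {zero}  eq = contradiction (here eq) (avoid i)
  inj′ {suc i} {suc j} eq = cong suc (inj eq)
  avoid′ : ∀ i → σ i ∉ L
  avoid′ zero    = x∉
  avoid′ (suc i) = avoid i ∘ there

-- Links depend only on twin classes, so a copy of `c k` made of twins has the links of `c k`;
-- copies within one part are unlinked because `c k` is independent.
tripartiteModel : (G : Graph n) (t : ℕ) (c : Fin 3 → Cell G) →
  (∀ k → TwinFamily G (3 * t + 3 * t) (proj₁ (c k))) →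
  (∀ k → TwinFamily G (3 * t + 3 * t) (proj₂ (c k))) →
  (∀ k → ¬ Linked G (c k) (c k)) → (∀ {k l} → k ≢ l → Linked G (c k) (c l)) →
  Model (completeTripartite t) G
tripartiteModel G t c fam₁ fam₂ indep link
  with p , p∈ , p-inj , _  ← distinctChoice (3 * t) (λ i → proj₁ (fam₁ (quotient t i))) [] (m≤m+n _ _)
  -- The second vertices must also avoid the `3 * t` first ones, whence families of size
  -- `3 * t + 3 * t`.
  with q , q∈ , q-inj , q∉ ← distinctChoice (3 * t) (λ i → proj₁ (fam₂ (quotient t i))) (tabulate p)
                               (+-monoˡ-≤ (3 * t) (≤-reflexive (length-tabulate p)))
  = cellModel G (λ i → p i , q i) disj (λ {i} {j} → mk⇔
      (λ i≢j → linked-twin G (twins i) (twins j) (link i≢j))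
      (λ l i≡j → indep _ (subst (λ k → Linked G (c (part i)) (c k)) (sym i≡j)
                   (linked-twin G (twins⁻ i) (twins⁻ j) l))))
  where
  part : Fin (3 * t) → Fin 3
  part = quotient t
  twins : ∀ i → TwinCell G (c (part i)) (p i , q i)
  twins i = (let a , eq = p∈ i in subst (Twin G _) eq (proj₂ (fam₁ (part i)) a))
          , (let a , eq = q∈ i in subst (Twin G _) eq (proj₂ (fam₂ (part i)) a))
  twins⁻ : ∀ i → TwinCell G (p i , q i) (c (part i))
  twins⁻ i = twin-sym G (proj₁ (twins i)) , twin-sym G (proj₂ (twins i))
  disj : ∀ {i j} → i ≢ j → Disjoint G (p i , q i) (p j , q j)
  disj i≢j (inj₁ refl) (inj₁ pp) = i≢j (p-inj pp)
  disj {i} {j} i≢j (inj₁ refl) (inj₂ pq) = q∉ j (subst (_∈ tabulate p) pq (∈-tabulate⁺ i))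
  disj {i} {j} i≢j (inj₂ refl) (inj₁ qp) = q∉ i (subst (_∈ tabulate p) (sym qp) (∈-tabulate⁺ j))
  disj i≢j (inj₂ refl) (inj₂ qq) = i≢j (q-inj qq)

-- Obstructions to extended bicliques

module _ {n} (G : Graph n) where

  -- The pairs may overlap or degenerate to a single vertex, so that a triangle, a P₄
  -- and a 2K₂ all give an obstruction.
  Obstruction : Cell G → Cell G → Cell G → Set
  Obstruction u v w = ¬ Adj G (proj₁ u) (proj₂ u) × ¬ Adj G (proj₁ v) (proj₂ v) × ¬ Adj G (proj₁ w) (proj₂ w) ×
                      Linked G u v × Linked G u w × Linked G v w

  Obstructed : Set
  Obstructed = ∃₂ λ a a′ → ∃₂ λ b b′ → ∃₂ λ c c′ → Obstruction (a , a′) (b , b′) (c , c′)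

  obstructed? : Dec Obstructed
  obstructed? = any? λ a → any? λ a′ → any? λ b → any? λ b′ → any? λ c → any? λ c′ →
    ¬? (adj? G a a′) ×-dec ¬? (adj? G b b′) ×-dec ¬? (adj? G c c′) ×-dec
    linked? G (a , a′) (b , b′) ×-dec linked? G (a , a′) (c , c′) ×-dec linked? G (b , b′) (c , c′)

  module _ (unobstructed : ¬ Obstructed) where

    -- Otherwise {a , d}, {b}, {c} is an obstruction. The case of equal ends `a` and `d` excludes
    -- triangles.
    shortcut : ∀ {a b c d} → Adj G a b → Adj G b c → Adj G c d → Adj G a d
    shortcut {a} {b} {c} {d} ab bc cd = decidable-stable (adj? G a d) λ a≁d →
      unobstructed (a , d , b , b , c , c , a≁d , adj-irrefl G refl , adj-irrefl G refl ,
        (a , b , inj₁ refl , inj₁ refl , ab) ,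
        (d , c , inj₂ refl , inj₁ refl , adj-sym G cd) ,
        (b , c , inj₁ refl , inj₁ refl , bc))

    -- Otherwise {a , x}, {a , y}, {b} is an obstruction: xy links the first two, and ab links both
    -- to the third.
    edges-meet : ∀ {a b x y} → Adj G a b → Adj G x y → ¬ Adj G a x → ¬ ¬ Adj G a y
    edges-meet {a} {b} {x} {y} ab xy a≁x a≁y =
      unobstructed (a , x , a , y , b , b , a≁x , a≁y , adj-irrefl G refl ,
        (x , y , inj₂ refl , inj₂ refl , xy) ,
        (a , b , inj₁ refl , inj₁ refl , ab) ,
        (a , b , inj₁ refl , inj₁ refl , ab))

    triangle-free : ∀ {a b c} → Adj G a b → Adj G b c → ¬ Adj G c a
    triangle-free ab bc ca = adj-irrefl G refl (shortcut ab bc ca)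

    module _ {a b} (ab : Adj G a b) where

      Plays : Fin n → Role → Set
      Plays x left     = Adj G x b
      Plays x right    = Adj G x a
      Plays x isolated = ¬ Adj G x a × ¬ Adj G x b

      cast : ∀ x → Σ Role (Plays x)
      cast x with adj? G x b | adj? G x a
      ... | yes xb | _      = left , xb
      ... | no _   | yes xa = right , xa
      ... | no x≁b | no x≁a = isolated , x≁a , x≁b

      -- A left and a right vertex are the ends of a walk through `ab`, so `shortcut` joins them. An
      -- edge within a side closes a triangle, an edge from a side to an isolated vertex extends to
      -- a walk reaching `a` or `b`, and an edge between isolated vertices contradicts `edges-meet`.
      plays-joined : ∀ {x y} r s → Plays x r → Plays y s → Adj G x y ⇔ Joined r s
      plays-joined left     left     xb yb = mk⇔ (λ xy → contradiction (adj-sym G xb) (triangle-free xy yb)) λ ()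
      plays-joined left     right    xb ya = mk⇔ (const left-right) λ _ → shortcut xb (adj-sym G ab) (adj-sym G ya)
      plays-joined left     isolated xb (y≁a , _) =
        mk⇔ (λ xy → contradiction (shortcut (adj-sym G xy) xb (adj-sym G ab)) y≁a) λ ()
      plays-joined right    left     xa yb = mk⇔ (const right-left) λ _ → shortcut xa ab (adj-sym G yb)
      plays-joined right    right    xa ya = mk⇔ (λ xy → contradiction (adj-sym G xa) (triangle-free xy ya)) λ ()
      plays-joined right    isolated xa (_ , y≁b) =
        mk⇔ (λ xy → contradiction (shortcut (adj-sym G xy) xa ab) y≁b) λ ()
      plays-joined isolated left     (x≁a , _) yb =
        mk⇔ (λ xy → contradiction (shortcut xy yb (adj-sym G ab)) x≁a) λ ()
      plays-joined isolated right    (_ , x≁b) ya =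
        mk⇔ (λ xy → contradiction (shortcut xy ya ab) x≁b) λ ()
      plays-joined isolated isolated (x≁a , _) (y≁a , _) =
        mk⇔ (λ xy → contradiction (y≁a ∘ adj-sym G) (edges-meet ab xy (x≁a ∘ adj-sym G))) λ ()

    unobstructed⇒biclique : IsExtendedBiclique G
    unobstructed⇒biclique with any? (λ a → any? (adj? G a))
    ... | yes (a , b , ab) = proj₁ ∘ cast ab , λ x y → plays-joined ab _ _ (proj₂ (cast ab x)) (proj₂ (cast ab y))
    ... | no  edgeless     = const isolated , λ x y → mk⇔ (λ xy → contradiction (x , y , xy) edgeless) λ ()

-- The obstruction is found in the remaining graph `K`, but its copies are made of twins in `G`,
-- where deleted vertices are available again.
obstructed⇒tripartite : {G : Graph n} {K : Graph m} (e : Fin m → Fin n) →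
  (∀ {x y} → Adj K x y ⇔ Adj G (e x) (e y)) → ∀ t →
  (∀ x → TwinFamily G (3 * t + 3 * t) (e x)) → Obstructed K → Model (completeTripartite t) G
obstructed⇒tripartite {G = G} {K} e e-adj t fam
  (a , a′ , b , b′ , c , c′ , a≁a′ , b≁b′ , c≁c′ , ab , ac , bc) =
  tripartiteModel G t (image ∘ cell) (fam ∘ proj₁ ∘ cell) (fam ∘ proj₂ ∘ cell)
    (λ k → independentCell G (cell-indep k ∘ from e-adj)) (λ k≢l → image-linked (cell-linked _ _ k≢l))
  where
  image : Cell K → Cell G
  image (p , q) = e p , e q
  hit-image : ∀ {c x} → Hit K c x → Hit G (image c) (e x)
  hit-image (inj₁ refl) = inj₁ refl
  hit-image (inj₂ refl) = inj₂ refl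
  image-linked : ∀ {c d} → Linked K c d → Linked G (image c) (image d)
  image-linked (x , y , cx , dy , xy) = e x , e y , hit-image cx , hit-image dy , to e-adj xy
  cell : Fin 3 → Cell K
  cell zero             = a , a′
  cell (suc zero)       = b , b′
  cell (suc (suc zero)) = c , c′
  cell-indep : ∀ k → ¬ Adj K (proj₁ (cell k)) (proj₂ (cell k))
  cell-indep zero             = a≁a′
  cell-indep (suc zero)       = b≁b′
  cell-indep (suc (suc zero)) = c≁c′
  cell-linked : ∀ k l → k ≢ l → Linked K (cell k) (cell l)
  cell-linked zero             zero             k≢k = contradiction refl k≢k
  cell-linked zero             (suc zero)       _   = ab
  cell-linked zero             (suc (suc zero)) _   = ac
  cell-linked (suc zero)       zero             _   = linked-sym K ab
  cell-linked (suc zero)       (suc zero)       k≢k = contradiction refl k≢k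
  cell-linked (suc zero)       (suc (suc zero)) _   = bc
  cell-linked (suc (suc zero)) zero             _   = linked-sym K ac
  cell-linked (suc (suc zero)) (suc zero)       _   = linked-sym K bc
  cell-linked (suc (suc zero)) (suc (suc zero)) k≢k = contradiction refl k≢k

-- Combining the three outcomes

theorem1p15 : Σ (ℕ → ℕ) λ f →
    ∀ {n : ℕ} (H : Graph n) (t : ℕ) → 1 ≤ t →
    (complete t IsProjectionOf H)
    ⊎ (completeTripartite t IsProjectionOf H)
    ⊎ (∃ λ k → ∃ λ m → Σ (Graph m) λ H′ →
    k ≤ f t × DeletesTo k H H′ × IsExtendedBiclique H′)
-- At most `separatedBound t` twin classes remain in the second case, and at most `3 * t + 3 * t`
-- vertices are deleted from each.
theorem1p15 = (λ t → separatedBound t * (3 * t + 3 * t)) , trichotomy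
  where
  trichotomy : ∀ {n : ℕ} (H : Graph n) (t : ℕ) → 1 ≤ t →
    (complete t IsProjectionOf H)
    ⊎ (completeTripartite t IsProjectionOf H)
    ⊎ (∃ λ k → ∃ λ m → Σ (Graph m) λ H′ →
    k ≤ separatedBound t * (3 * t + 3 * t) × DeletesTo k H H′ × IsExtendedBiclique H′)
  trichotomy {n} H t _ with rs , sep , cover ← representatives H (allFin n)
    with ≤-total (separatedBound t) (length rs)
  ... | inj₁ many = inj₁ (model⇒projection (manySeparated⇒complete H t (rs , many , sep)))
  ... | inj₂ few
    with deletion {count} {size} H′ c≤ d e _ e-adj avoids
           ← deleteAll H (truncatedClasses H (3 * t + 3 * t) rs)
    with obstructed? H′
  ... | yes obstructed = inj₂ (inj₁ (model⇒projection (obstructed⇒tripartite {K = H′} e e-adj t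
          (λ x → twinFamily H _ rs (All.lookup cover (∈-allFin (e x))) (avoids x)) obstructed)))
  ... | no unobstructed = inj₂ (inj₂ (count , size , H′ ,
          ≤-trans c≤ (≤-trans (length-truncatedClasses H _ rs) (*-monoˡ-≤ (3 * t + 3 * t) few)) ,
          d , unobstructed⇒biclique H′ unobstructed))
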